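{- Let $\mathcal J$ be an ideal on $\omega$. (1) The following conditions are equivalent: (a) $\mathcal J$ is extendable to a selective ideal (i.e. $\mathcal J\subseteq\mathcal J'$ for some selective ideal $\mathcal J'$ on $\omega$); (b) $\mathcal{ED}\not\preceq^{\omega_1}_{\omega^\omega,1-1}\mathcal J$; (c) $\mathcal{ED}\not\preceq^{\omega_1}_{\omega^\omega,\mathrm{Fin}-1}\mathcal J$; (d) $\mathcal{ED}\not\preceq^{\omega_1}_{\omega^\omega,\omega^\omega}\mathcal J$. (2) Under CH, the conditions (a), (b), (c), (d) listed in (1) are equivalent to each of the following: (e) there is a selective ultrafilter which is not a $\mathcal J$-point; (f) there is a selective ultrafilter which is not a weak $\mathcal J$-ultrafilter; (g) there is a selective ultrafilter which is not a $\mathcal J$-ultrafilter.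
   Context: An ideal on a set $X$ is a family of subsets of $X$ closed under finite unions and subsets, containing all finite subsets of $X$ and not containing $X$; $\mathcal J^+=\mathcal P(X)\setminus\mathcal J$. Ideals on countably infinite sets are regarded as ideals on $\omega$ via fixed bijections. $\mathcal{ED}=\{A\subseteq\omega\times\omega:\exists m$ such that for all but finitely many $n$, $|\{k:(n,k)\in A\}|<m\}$. $\mathcal J$ is a selective ideal if for every decreasing sequence $(A_n)_{n\in\omega}$ of sets in $\mathcal J^+$ there is $A\in\mathcal J^+$, $A\subseteq A_0$, such that $|A\cap(A_n\setminus A_{n+1})|\le1$ for every $n$. For $\mathcal F\subseteq\omega^\omega$ and ideals $\mathcal I,\mathcal K$ on $\omega$, $\mathcal I\le_{\mathcal F}\mathcal K$ means that there is $f\in\mathcal F$ with $f^{ -1}[B]\in\mathcal K$ for every $B\in\mathcal I$. $\mathrm{Fin}-1$ and $1-1$ denote the families of all finite-to-one, respectively one-to-one, functions $\omega\to\omega$. For an ideal $\mathcal K$ on $\omega$ and $\mathcal A\subseteq\mathcal P(\omega)$, $\mathcal K(\mathcal A)=\{B\subseteq\omega:\exists F\in[\mathcal A]^{<\omega}\ (B\setminus\bigcup F\in\mathcal K)\}$. $\mathcal I\preceq^{\omega_1}_{\mathcal F,\mathcal G}\mathcal J$ means: for each ideal $\mathcal J'$ on $\omega$ with $\mathcal J\le_{\mathcal G}\mathcal J'$ there is a countable $\mathcal A\subseteq\mathcal P(\omega)$ with $\omega\notin\mathcal J'(\mathcal A)$ and $\mathcal I\le_{\mathcal F}\mathcal J'(\mathcal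 A)$. Ultrafilters on $\omega$ contain all cofinite sets; $\mathcal U^*=\{\omega\setminus A:A\in\mathcal U\}$. $\mathcal U$ is a selective (Ramsey) ultrafilter if $\mathcal U^*$ is a selective ideal. $\mathcal U$ is a $\mathcal J$-ultrafilter (weak $\mathcal J$-ultrafilter, $\mathcal J$-point) if $\mathcal J\not\le_{\mathcal F}\mathcal U^*$ for $\mathcal F=\omega^\omega$ ($\mathrm{Fin}-1$, $1-1$, respectively). -}

module Defs where

open import Level using (Level; 0ℓ; suc; _⊔_)
open import Data.Nat.Base using (ℕ; _≤_; _<_) renaming (suc to 1+_)
open import Data.List.Base using (List; length; foldr)
open import Data.List.Membership.Propositional using () renaming (_∈_ to _∈ˡ_)
open import Data.List.Relation.Unary.All using (All)
open import Data.Product.Base using (∃; ∃-syntax; _×_; _,_)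
open import Data.Sum.Base using (_⊎_)
open import Function.Bundles using (_↔_; Inverse; Bijection)
open import Function.Definitions using (Injective)
open import Induction.WellFounded using (WellFounded)
open import Relation.Binary.Core using (Rel)
open import Relation.Binary.PropositionalEquality.Core using (_≡_)
open import Relation.Binary.PropositionalEquality.Properties using (setoid)
open import Relation.Binary.Structures using (IsStrictTotalOrder)
open import Relation.Nullary.Negation.Core using (¬_)
open import Relation.Unary
  using (Pred; _∈_; _∉_; _⊆_; _≐_; _∪_; _∩_; _∖_; ∁; ∅; U; Empty; _⊢_; ｛_｝)
open import Relation.Unary.Relation.Binary.Equality using (≐-setoid)

private
  variable
    a ℓ ℓ₁ ℓ₂ : Level
    X : Set

-- Sets of points are level-0 predicates and are compared by `_≐_`.  Families
-- are not required to respect `_≐_`, but ideals and filters do so automatically,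
-- being closed under subsets and supersets respectively.

𝒫 : Set → Set₁
𝒫 X = Pred X 0ℓ

Family : Set → (ℓ : Level) → Set (suc 0ℓ ⊔ suc ℓ)
Family X ℓ = Pred (𝒫 X) ℓ

-- The covering list may have repetitions and superfluous entries, so this says
-- that the cardinality is at most n.

∣_∣≤_ : 𝒫 X → ℕ → Set
∣ A ∣≤ n = ∃[ xs ] length xs ≤ n × (∀ x → x ∈ A → x ∈ˡ xs)

∣_∣<_ : 𝒫 X → ℕ → Set
∣ A ∣< m = ∃[ n ] n < m × ∣ A ∣≤ n

Finite : 𝒫 X → Set
Finite A = ∃[ n ] ∣ A ∣≤ n

Cofinite : 𝒫 X → Set
Cofinite A = Finite (∁ A)

-- Countable (possibly finite) up to `_≈_`.  The sequence may leave A, which is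
-- harmless since subsets of countable sets are countable.

Countable : {Y : Set a} → Rel Y ℓ₁ → Pred Y ℓ₂ → Set (a ⊔ ℓ₁ ⊔ ℓ₂)
Countable {Y = Y} _≈_ A =
  Empty A ⊎ (∃ λ (s : ℕ → Y) → ∀ y → y ∈ A → ∃[ n ] s n ≈ y)

record IsIdeal (𝒥 : Family X ℓ) : Set (suc 0ℓ ⊔ ℓ) where
  field
    ∪-closed : ∀ A B → A ∈ 𝒥 → B ∈ 𝒥 → A ∪ B ∈ 𝒥
    ⊆-closed : ∀ A B → A ⊆ B → B ∈ 𝒥 → A ∈ 𝒥
    finite   : ∀ A → Finite A → A ∈ 𝒥
    proper   : U ∉ 𝒥

_⁺ : Family X ℓ → Family X ℓ
𝒥 ⁺ = ∁ 𝒥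

record IsSelectiveIdeal (𝒥 : Family X ℓ) : Set (suc 0ℓ ⊔ ℓ) where
  field
    isIdeal  : IsIdeal 𝒥
    selector : (A : ℕ → 𝒫 X) →
               (∀ n → A n ∈ 𝒥 ⁺) →
               (∀ n → A (1+ n) ⊆ A n) →
               ∃[ S ] S ∈ 𝒥 ⁺ × S ⊆ A 0 × (∀ n → ∣ S ∩ (A n ∖ A (1+ n)) ∣≤ 1)

ExtendableToSelective : Family ℕ 0ℓ → Set₁
ExtendableToSelective 𝒥 =
  ∃ λ (𝒥′ : Family ℕ 0ℓ) → IsSelectiveIdeal 𝒥′ × (∀ A → A ∈ 𝒥 → A ∈ 𝒥′)

ℰ𝒟 : Family (ℕ × ℕ) 0ℓ
ℰ𝒟 A = ∃[ m ] Cofinite (λ n → ∣ (λ k → (n , k) ∈ A) ∣< m)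

-- A ⊆ ω belongs to the transported family iff its image under the bijection,
-- i.e. its preimage under the inverse bijection, belongs to the original one.

onω : ℕ ↔ X → Family X ℓ → Family ℕ ℓ
onω e 𝒥 A = (Inverse.from e ⊢ A) ∈ 𝒥

ω^ω : Pred (ℕ → ℕ) 0ℓ
ω^ω = U

Fin-1 : Pred (ℕ → ℕ) 0ℓ
Fin-1 f = ∀ n → Finite (f ⊢ ｛ n ｝)

1-1 : Pred (ℕ → ℕ) 0ℓ
1-1 = Injective _≡_ _≡_

_≤[_]_ : Family ℕ ℓ₁ → Pred (ℕ → ℕ) 0ℓ → Family ℕ ℓ₂ → Set (suc 0ℓ ⊔ ℓ₁ ⊔ ℓ₂)
ℐ ≤[ ℱ ] 𝒦 = ∃[ f ] f ∈ ℱ × (∀ B → B ∈ ℐ → (f ⊢ B) ∈ 𝒦)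

⋃ˡ : List (𝒫 X) → 𝒫 X
⋃ˡ = foldr _∪_ ∅

_⟨_⟩ : Family X ℓ → Family X 0ℓ → Family X (suc 0ℓ ⊔ ℓ)
(𝒦 ⟨ 𝒜 ⟩) B = ∃[ Fs ] All (_∈ 𝒜) Fs × (B ∖ ⋃ˡ Fs) ∈ 𝒦

_≼ω₁[_,_]_ : Family ℕ 0ℓ → Pred (ℕ → ℕ) 0ℓ → Pred (ℕ → ℕ) 0ℓ → Family ℕ 0ℓ → Set₁
ℐ ≼ω₁[ ℱ , 𝒢 ] 𝒥 =
  (𝒥′ : Family ℕ 0ℓ) → IsIdeal 𝒥′ → 𝒥 ≤[ 𝒢 ] 𝒥′ →
  ∃ λ (𝒜 : Family ℕ 0ℓ) →
    Countable _≐_ 𝒜 × U ∉ 𝒥′ ⟨ 𝒜 ⟩ × ℐ ≤[ ℱ ] (𝒥′ ⟨ 𝒜 ⟩)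

record IsUltrafilter (𝒰 : Family ℕ 0ℓ) : Set₁ where
  field
    ∩-closed : ∀ A B → A ∈ 𝒰 → B ∈ 𝒰 → A ∩ B ∈ 𝒰
    ⊇-closed : ∀ A B → A ⊆ B → A ∈ 𝒰 → B ∈ 𝒰
    cofinite : ∀ A → Cofinite A → A ∈ 𝒰
    proper   : ∅ ∉ 𝒰
    ultra    : ∀ A → A ∈ 𝒰 ⊎ ∁ A ∈ 𝒰

_* : Family X ℓ → Family X (suc 0ℓ ⊔ ℓ)
(𝒰 *) B = ∃[ A ] A ∈ 𝒰 × B ≐ ∁ A

IsSelectiveUltrafilter : Family ℕ 0ℓ → Set₁
IsSelectiveUltrafilter 𝒰 = IsUltrafilter 𝒰 × IsSelectiveIdeal (𝒰 *)

_-ultrafilter _-weakUltrafilter _-point : Family ℕ 0ℓ → Family ℕ 0ℓ → Set₁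
(𝒥 -ultrafilter)     𝒰 = ¬ (𝒥 ≤[ ω^ω ] (𝒰 *))
(𝒥 -weakUltrafilter) 𝒰 = ¬ (𝒥 ≤[ Fin-1 ] (𝒰 *))
(𝒥 -point)           𝒰 = ¬ (𝒥 ≤[ 1-1 ] (𝒰 *))

-- The order type ω₁: an uncountable well-order all of whose proper initial
-- segments are countable.

record IsOmega₁ (W : Set) (_≺_ : Rel W 0ℓ) : Set where
  field
    isStrictTotalOrder : IsStrictTotalOrder _≡_ _≺_
    wellFounded        : WellFounded _≺_
    countableSegments  : ∀ w → Countable _≡_ (_≺ w)
    uncountable        : ¬ Countable {Y = W} _≡_ U

-- 2^ℵ₀ = ℵ₁: the set ω₁ is in bijection with the power set of ω.

CH : Set₁
CH = ∃ λ (W : Set) → ∃ λ (_≺_ : Rel W 0ℓ) →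
       IsOmega₁ W _≺_ × Bijection (setoid W) (≐-setoid ℕ 0ℓ)

{-# OPTIONS --safe #-}

-- If ℐ is selective, every countable family whose finite intersections are
-- ℐ-positive has an ℐ-positive pseudo-intersection S.  Applied to complements of
-- the members of a countable 𝒜 with ω ∉ ℐ(𝒜), it makes the traces on S of
-- sets from ℐ(𝒜) lie in ℐ; a function witnessing ℰ𝒟 ≤ ℐ(𝒜) then hits every column
-- in an ℐ-small part of S, so it meets each column at most once on an ℐ-positive
-- T ⊆ S, whereas f[T] ∈ ℰ𝒟.
--
-- Conversely, let ℐ witness that ℰ𝒟 is not below 𝒥, with 𝒥 ≤ ℐ via g.  The
-- pushforward of ℐ along g contains 𝒥 and is itself selective: a decreasing sequence
-- (Aₙ) of positive sets yields 𝒜 = {ω ∖ g⁻¹[Aₙ]}, and the function sending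
-- Aₙ ∖ Aₙ₊₁ injectively into column n fails for some B ∈ ℰ𝒟, whose preimage splits
-- into finitely many partial selectors, one of which is positive.
--
-- Under CH, a selective ℐ extends to the dual of a selective ultrafilter, generated by
-- a ⊆*-decreasing ω₁-tower of ℐ-positive sets on which, in turn, every h : ω → ω is
-- made constant or injective.

module Submission where

open import Defs
open import Level using (lift; lower; 0ℓ; suc; _⊔_)
open import Axiom.ExcludedMiddle using (ExcludedMiddle)
open import Data.Empty using (⊥-elim)
open import Data.Fin.Base using (toℕ)
open import Data.Fin.Properties using (toℕ-injective; toℕ<n)
open import Data.List.Base using (List; []; _∷_; _++_; map; upTo)
open import Data.List.Membership.Propositional using () renaming (_∈_ to _∈ˡ_)
open import Data.List.Membership.Propositional.Properties using (∈-++⁺ˡ; ∈-++⁺ʳ; ∈-upTo⁺)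
open import Data.List.Membership.Setoid.Properties using (index-injective)
open import Data.List.Relation.Unary.All using (All; []; _∷_; universal)
open import Data.List.Relation.Unary.All.Properties using (map⁺)
open import Data.List.Relation.Unary.Any using (here; there; index)
open import Data.Nat.Base using (ℕ; zero; _≤_; _<_; z≤n; s≤s; s≤s⁻¹) renaming (suc to 1+_; _⊔_ to _⊔ℕ_)
open import Data.Nat.Properties
  using (≤-refl; ≤-reflexive; ≤-trans; <-≤-trans; <-cmp; ≮⇒≥; m<n⇒m<1+n; n<1+n; n≤1+n;
         m<1+n⇒m<n∨m≡n; _<?_; <⇒≱; <⇒≤; m≤m⊔n; m≤n⊔m; m≤n⇒m<n∨m≡n)
open import Data.Product.Base using (∃; ∃-syntax; _×_; _,_; proj₁; proj₂)
open import Data.Sum.Base using (_⊎_; inj₁; inj₂; [_,_]′)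
open import Data.Unit.Base using (tt)
open import Function.Base using (id; _∘_)
open import Function.Bundles using (_⇔_; _↔_; mk⇔; Inverse; Bijection)
open import Induction.WellFounded using (module All; module FixPoint)
open import Relation.Binary.Core using (Rel)
open import Relation.Binary.Structures using (IsStrictTotalOrder)
open import Relation.Binary.Definitions using (tri<; tri≈; tri>)
open import Relation.Binary.PropositionalEquality
  using (_≡_; refl; sym; trans; cong; subst; setoid)
open import Relation.Nullary.Decidable using (Dec; yes; no; map′; decidable-stable)
open import Relation.Nullary.Negation.Core using (¬_; contradiction)
open import Relation.Unary
  using (Pred; _∈_; _∉_; _⊆_; _⊈_; _≐_; _∪_; _∩_; _∖_; ∁; ∅; U; Empty; _⊢_)

-- Finite sets, almost inclusion, and layers of decreasing sequences.

module _ {X : Set} where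

  ∣∣≤-⊆ : {A B : 𝒫 X} {n : ℕ} → A ⊆ B → ∣ B ∣≤ n → ∣ A ∣≤ n
  ∣∣≤-⊆ A⊆B (xs , l , c) = xs , l , λ x x∈A → c x (A⊆B x∈A)

  finite-⊆ : {A B : 𝒫 X} → A ⊆ B → Finite B → Finite A
  finite-⊆ A⊆B (n , B≤n) = n , ∣∣≤-⊆ A⊆B B≤n

  finite-∪ : {A B : 𝒫 X} → Finite A → Finite B → Finite (A ∪ B)
  finite-∪ (_ , xs , _ , c) (_ , ys , _ , d) =
    _ , xs ++ ys , ≤-refl ,
    λ x → [ (λ p → ∈-++⁺ˡ (c x p)) , (λ p → ∈-++⁺ʳ xs (d x p)) ]′

  empty⇒finite : {A : 𝒫 X} → Empty A → Finite A
  empty⇒finite e = 0 , [] , z≤n , λ x x∈A → contradiction x∈A (e x)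

  AtMostOne : 𝒫 X → Set
  AtMostOne A = ∀ {x y} → x ∈ A → y ∈ A → x ≡ y

  ≤1⇒atMostOne : {A : 𝒫 X} → ∣ A ∣≤ 1 → AtMostOne A
  ≤1⇒atMostOne ([] , _ , c) p q with () ← c _ p
  ≤1⇒atMostOne (z ∷ [] , _ , c) p q with here refl ← c _ p | here refl ← c _ q = refl
  ≤1⇒atMostOne (_ ∷ _ ∷ _ , s≤s () , _)

  infix 4 _⊆*_
  _⊆*_ : 𝒫 X → 𝒫 X → Set
  A ⊆* B = Finite (A ∖ B)

  ⊆⇒⊆* : {A B : 𝒫 X} → A ⊆ B → A ⊆* B
  ⊆⇒⊆* A⊆B = empty⇒finite λ x (p , q) → q (A⊆B p)

  ConstantOn InjectiveOn Homogeneous : (X → ℕ) → 𝒫 X → Set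
  ConstantOn h A = ∀ {x y} → x ∈ A → y ∈ A → h x ≡ h y
  InjectiveOn h A = ∀ {x y} → x ∈ A → y ∈ A → h x ≡ h y → x ≡ y
  Homogeneous h A = ConstantOn h A ⊎ InjectiveOn h A

  homogeneous-resp : {h h′ : X → ℕ} {A B : 𝒫 X} → (∀ x → h′ x ≡ h x) → A ⊆ B →
                     Homogeneous h B → Homogeneous h′ A
  homogeneous-resp h′≡h A⊆B (inj₁ const) =
    inj₁ λ p q → trans (h′≡h _) (trans (const (A⊆B p) (A⊆B q)) (sym (h′≡h _)))
  homogeneous-resp h′≡h A⊆B (inj₂ inj) =
    inj₂ λ p q eq → inj (A⊆B p) (A⊆B q) (trans (sym (h′≡h _)) (trans eq (h′≡h _)))

  image : {Y : Set} → (X → Y) → 𝒫 X → 𝒫 Y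
  image f A y = ∃[ x ] x ∈ A × f x ≡ y

  ⋂< : (ℕ → 𝒫 X) → ℕ → 𝒫 X
  ⋂< C zero = U
  ⋂< C (1+ n) = ⋂< C n ∩ C n

  ∈⋃ˡ-map : {Y : Set} (F : Y → 𝒫 X) {ys : List Y} {y : Y} →
            y ∈ˡ ys → F y ⊆ ⋃ˡ (map F ys)
  ∈⋃ˡ-map F (here refl) p = inj₁ p
  ∈⋃ˡ-map F (there q)   p = inj₂ (∈⋃ˡ-map F q p)

  antitone : {A : ℕ → 𝒫 X} → (∀ n → A (1+ n) ⊆ A n) → ∀ {m n} → m ≤ n → A n ⊆ A m
  antitone dec {n = zero} z≤n p = p
  antitone dec {n = 1+ n} m≤1+n p with m≤n⇒m<n∨m≡n m≤1+n
  ... | inj₁ m<1+n = antitone dec (s≤s⁻¹ m<1+n) (dec n p)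
  ... | inj₂ refl  = p

  layer-unique : {A : ℕ → 𝒫 X} → (∀ n → A (1+ n) ⊆ A n) → ∀ {m n x} →
                 x ∈ A m ∖ A (1+ m) → x ∈ A n ∖ A (1+ n) → m ≡ n
  layer-unique dec {m} {n} (p , p′) (q , q′) with <-cmp m n
  ... | tri< m<n _ _ = contradiction (antitone dec m<n q) p′
  ... | tri≈ _ m≡n _ = m≡n
  ... | tri> _ _ n<m = contradiction (antitone dec n<m p) q′

-- Bridges universe levels: `𝒰 *` lies one level above `dual 𝒰`, while the ideals quantified over in
-- `_≼ω₁[_,_]_` have level 0.
IsSelectiveIdeal-resp : ∀ {ℓ₁ ℓ₂} {X : Set} {𝒥 : Family X ℓ₁} {𝒦 : Family X ℓ₂} →
  (∀ {A} → A ∈ 𝒥 → A ∈ 𝒦) → (∀ {A} → A ∈ 𝒦 → A ∈ 𝒥) →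
  IsSelectiveIdeal 𝒥 → IsSelectiveIdeal 𝒦
IsSelectiveIdeal-resp to from sel = record
  { isIdeal = record
    { ∪-closed = λ A B p q → to (∪-closed A B (from p) (from q))
    ; ⊆-closed = λ A B A⊆B q → to (⊆-closed A B A⊆B (from q))
    ; finite   = λ A f → to (finite A f)
    ; proper   = proper ∘ from
    }
  ; selector = λ A pos dec →
      let S , S⁺ , rest = selector A (λ n → pos n ∘ to) dec in S , S⁺ ∘ from , rest
  }
  where
  open IsSelectiveIdeal sel
  open IsIdeal isIdeal

-- Closure properties of ideals and pushforwards.

module Ideal {ℓ} {X : Set} {ℐ : Family X ℓ} (isIdeal : IsIdeal ℐ) where
  open IsIdeal isIdeal public

  ⊆-∪-closed : {A B C : 𝒫 X} → A ⊆ B ∪ C → B ∈ ℐ → C ∈ ℐ → A ∈ ℐ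
  ⊆-∪-closed A⊆B∪C p q = ⊆-closed _ _ A⊆B∪C (∪-closed _ _ p q)

  ⋃<-closed : (T : ℕ → 𝒫 X) → ∀ m → (∀ i → i < m → T i ∈ ℐ) →
              (λ x → ∃[ i ] i < m × x ∈ T i) ∈ ℐ
  ⋃<-closed T zero _ = finite _ (empty⇒finite λ { _ (_ , () , _) })
  ⋃<-closed T (1+ m) all =
    ⊆-∪-closed cover (⋃<-closed T m (λ i i<m → all i (m<n⇒m<1+n i<m))) (all m (n<1+n m))
    where
    cover : (λ x → ∃[ i ] i < 1+ m × x ∈ T i) ⊆ (λ x → ∃[ i ] i < m × x ∈ T i) ∪ T m
    cover (i , i<1+m , p) with m<1+n⇒m<n∨m≡n i<1+m
    ... | inj₁ i<m  = inj₁ (i , i<m , p)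
    ... | inj₂ refl = inj₂ p

pushforward : (ℕ → ℕ) → Family ℕ 0ℓ → Family ℕ 0ℓ
pushforward g ℐ B = (g ⊢ B) ∈ ℐ

pushforward-isIdeal : {𝒥 ℐ : Family ℕ 0ℓ} {g : ℕ → ℕ} → IsIdeal 𝒥 → IsIdeal ℐ →
                      (∀ B → B ∈ 𝒥 → (g ⊢ B) ∈ ℐ) → IsIdeal (pushforward g ℐ)
pushforward-isIdeal 𝒥-ideal ℐ-ideal 𝒥≤ℐ = record
  { ∪-closed = λ A B → ∪-closed _ _
  ; ⊆-closed = λ A B A⊆B → ⊆-closed _ _ A⊆B
  -- `g` may have infinite fibres, so finiteness does not pass to preimages; finite sets are small
  -- because `𝒥` contains them.
  ; finite   = λ A f → 𝒥≤ℐ A (IsIdeal.finite 𝒥-ideal A f)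
  ; proper   = proper
  }
  where open IsIdeal ℐ-ideal

-- Classical facts on almost inclusion and countable families.

module Classical (em₁ : ExcludedMiddle (suc 0ℓ)) where

  em : ExcludedMiddle 0ℓ
  em = map′ lower lift em₁

  ¬¬-elim : {P : Set} → ¬ ¬ P → P
  ¬¬-elim = decidable-stable em

  ⊆*-trans : {X : Set} {A B C : 𝒫 X} → A ⊆* B → B ⊆* C → A ⊆* C
  ⊆*-trans {A = A} {B} {C} A⊆*B B⊆*C = finite-⊆ split (finite-∪ A⊆*B B⊆*C)
    where
    split : A ∖ C ⊆ (A ∖ B) ∪ (B ∖ C)
    split {x} (p , q) with em {x ∈ B}
    ... | yes r = inj₂ (r , q)
    ... | no ¬r = inj₁ (p , ¬r)

  ⊆*-∩ : {X : Set} {A B C : 𝒫 X} → A ⊆* B → A ⊆* C → A ⊆* B ∩ C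
  ⊆*-∩ {A = A} {B} {C} A⊆*B A⊆*C = finite-⊆ split (finite-∪ A⊆*B A⊆*C)
    where
    split : A ∖ (B ∩ C) ⊆ (A ∖ B) ∪ (A ∖ C)
    split {x} (p , q) with em {x ∈ B}
    ... | yes r = inj₂ (p , λ s → q (r , s))
    ... | no ¬r = inj₁ (p , ¬r)

  ⊆*-closed : {X : Set} {ℐ : Family X 0ℓ} → IsIdeal ℐ → {A B : 𝒫 X} → A ⊆* B → B ∈ ℐ → A ∈ ℐ
  ⊆*-closed ideal {A} {B} A⊆*B B∈ℐ = ⊆-∪-closed split B∈ℐ (finite _ A⊆*B)
    where
    open Ideal ideal
    split : A ⊆ B ∪ (A ∖ B)
    split {x} p with em {x ∈ B}
    ... | yes r = inj₁ r
    ... | no ¬r = inj₂ (p , ¬r)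

  positive⇒inhabited : {ℐ : Family ℕ 0ℓ} → IsIdeal ℐ → {A : 𝒫 ℕ} → A ∈ ℐ ⁺ → ∃[ x ] x ∈ A
  positive⇒inhabited ideal A⁺ = ¬¬-elim λ none →
    A⁺ (IsIdeal.finite ideal _ (empty⇒finite λ x p → none (x , p)))

  atMostOne⇒≤1 : {X : Set} {A : 𝒫 X} → AtMostOne A → ∣ A ∣≤ 1
  atMostOne⇒≤1 {A = A} unique with em {∃ A}
  ... | yes (z , z∈A) = z ∷ [] , ≤-refl , λ x x∈A → here (unique x∈A z∈A)
  ... | no none = [] , z≤n , λ x x∈A → contradiction (x , x∈A) none

  -- Makes a countable family total: indices whose term leaves `A`, and all indices if `A` is empty,
  -- receive `U`, which is neutral for intersections.
  enumerate : ∀ {a ℓ₁ ℓ₂} {Y : Set a} {_≈_ : Rel Y ℓ₁} {A : Pred Y ℓ₂} →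
    ExcludedMiddle (a ⊔ ℓ₁ ⊔ ℓ₂) → (F : Y → 𝒫 ℕ) →
    (∀ {x y z} → x ≈ y → x ≈ z → F y ⊆ F z) → Countable _≈_ A →
    ∃ λ (C : ℕ → 𝒫 ℕ) → (∀ y → y ∈ A → ∃[ n ] C n ⊆ F y) ×
                        (∀ n → U ⊆ C n ⊎ (∃ λ y → y ∈ A × F y ⊆ C n))
  enumerate emA F resp (inj₁ empty) = (λ _ → U) , (λ y y∈A → contradiction y∈A (empty y)) , λ _ → inj₁ id
  enumerate {Y = Y} {_≈_} {A} emA F resp (inj₂ (s , covers)) = C , covered , sound
    where
    C : ℕ → 𝒫 ℕ
    C n with emA {∃ λ y → y ∈ A × s n ≈ y}
    ... | yes (y , _) = F y
    ... | no _        = U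

    covered : ∀ y → y ∈ A → ∃[ n ] C n ⊆ F y
    covered y y∈A with covers y y∈A
    ... | n , sn≈y = n , C⊆
      where
      C⊆ : C n ⊆ F y
      C⊆ with emA {∃ λ y → y ∈ A × s n ≈ y}
      ... | yes (z , _ , sn≈z) = resp sn≈z sn≈y
      ... | no none = contradiction (y , y∈A , sn≈y) none

    sound : ∀ n → U ⊆ C n ⊎ (∃ λ y → y ∈ A × F y ⊆ C n)
    sound n with emA {∃ λ y → y ∈ A × s n ≈ y}
    ... | yes (y , y∈A , _) = inj₂ (y , y∈A , id)
    ... | no _ = inj₁ id

  -- Pseudo-intersections and homogeneous sets for selective ideals.

  module Selective {ℐ : Family ℕ 0ℓ} (sel : IsSelectiveIdeal ℐ) where
    open IsSelectiveIdeal sel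
    open Ideal isIdeal

    -- A selector for the finite intersections loses at most one point per layer, so only finitely
    -- many points before any given index.
    pseudoIntersection : (C : ℕ → 𝒫 ℕ) → (∀ n → ⋂< C n ∈ ℐ ⁺) →
                         ∃[ S ] S ∈ ℐ ⁺ × (∀ n → S ⊆* C n)
    pseudoIntersection C pos with selector (⋂< C) pos (λ _ → proj₁)
    ... | S , S⁺ , _ , one = S , S⁺ , λ n → ⊆*-trans (almost (1+ n)) (⊆⇒⊆* proj₂)
      where
      almost : ∀ n → S ⊆* ⋂< C n
      almost zero = ⊆⇒⊆* λ _ → tt
      almost (1+ n) = ⊆*-trans (⊆*-∩ (⊆⇒⊆* id) (almost n))
        (1 , ∣∣≤-⊆ (λ ((p , q) , ¬r) → p , q , ¬r) (one n))

    -- The layers of the sequence `S ∩ (λ x → n ≤ h x)` are the fibres of `h` on `S`, and a selector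
    -- meets each at most once.
    injectiveSubset : (h : ℕ → ℕ) (S : 𝒫 ℕ) → (∀ n → S ∩ (λ x → n ≤ h x) ∈ ℐ ⁺) →
                      ∃[ T ] T ∈ ℐ ⁺ × T ⊆ S × InjectiveOn h T
    injectiveSubset h S pos
      with T , T⁺ , T⊆ , one ← selector (λ n → S ∩ (λ x → n ≤ h x)) pos
             (λ n (p , q) → p , ≤-trans (n≤1+n n) q)
      = T , T⁺ , proj₁ ∘ T⊆ , λ {x} {y} p q hx≡hy →
          ≤1⇒atMostOne (one (h x))
            (p , (proj₁ (T⊆ p) , ≤-refl) , λ (_ , r) → <⇒≱ r ≤-refl)
            (q , (proj₁ (T⊆ q) , ≤-reflexive hx≡hy) , λ (_ , r) → <⇒≱ r (≤-reflexive (sym hx≡hy)))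

    -- Either some fibre of `h` on `S` is positive, or deleting finitely many fibres never destroys
    -- positivity and `injectiveSubset` applies.
    homogeneousSubset : (h : ℕ → ℕ) (S : 𝒫 ℕ) → S ∈ ℐ ⁺ →
                        ∃[ T ] T ∈ ℐ ⁺ × T ⊆ S × Homogeneous h T
    homogeneousSubset h S S⁺ with em {∃[ k ] S ∩ (λ x → h x ≡ k) ∈ ℐ ⁺}
    ... | yes (k , T⁺) = _ , T⁺ , proj₁ , inj₁ λ (_ , p) (_ , q) → trans p (sym q)
    ... | no none =
      let T , T⁺ , T⊆S , inj = injectiveSubset h S pos in T , T⁺ , T⊆S , inj₂ inj
      where
      pos : ∀ n → S ∩ (λ x → n ≤ h x) ∈ ℐ ⁺
      pos n small = S⁺ (⊆-∪-closed split small
        (⋃<-closed (λ k → S ∩ (λ x → h x ≡ k)) n λ k _ → ¬¬-elim λ T⁺ → none (k , T⁺)))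
        where
        split : S ⊆ (S ∩ (λ x → n ≤ h x)) ∪ (λ x → ∃[ k ] k < n × x ∈ S × h x ≡ k)
        split {x} p with h x <? n
        ... | yes hx<n = inj₂ (h x , hx<n , p , refl)
        ... | no hx≮n  = inj₁ (p , ≮⇒≥ hx≮n)

  -- Selective ideals against `ℰ𝒟`.

  module Columns (e : ℕ ↔ (ℕ × ℕ)) where
    open Inverse e using (to; from; strictlyInverseˡ)

    column : ℕ → ℕ
    column = proj₁ ∘ to

    columns-small : ∀ n → (λ y → column y < n) ∈ onω e ℰ𝒟
    -- With bound 1 a column must have empty section, which fails only for columns in `upTo n`.
    columns-small n = 1 , _ , upTo n , ≤-refl , λ i many → ∈-upTo⁺ (¬¬-elim λ i≮n →
      many (0 , s≤s z≤n , [] , z≤n , λ k ik<n →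
        contradiction (subst (_< n) (cong proj₁ (strictlyInverseˡ (i , k))) ik<n) i≮n))

    -- Two points of the image in one column come from the same point of `T`; hence the bound 2 and
    -- no exceptional columns.
    graph-small : (f : ℕ → ℕ) (T : 𝒫 ℕ) → InjectiveOn (column ∘ f) T →
                  image f T ∈ onω e ℰ𝒟
    graph-small f T inj = 2 , 0 , [] , z≤n , λ n many →
      contradiction (1 , ≤-refl , atMostOne⇒≤1 (unique n)) many
      where
      column-f : ∀ {n x k} → f x ≡ from (n , k) → column (f x) ≡ n
      column-f {n} {k = k} eq = trans (cong column eq) (cong proj₁ (strictlyInverseˡ (n , k)))

      unique : ∀ n → AtMostOne (λ k → ∃[ x ] x ∈ T × f x ≡ from (n , k))
      unique n {k} {l} (x , x∈T , fx) (y , y∈T , fy)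
        with refl ← inj x∈T y∈T (trans (column-f fx) (sym (column-f fy)))
        = cong proj₂ (trans (sym (strictlyInverseˡ (n , k)))
            (trans (cong to (trans (sym fx) fy)) (strictlyInverseˡ (n , l))))

    -- The relation fails at `ℐ` itself, so `𝒢` enters only through the witness of `𝒥 ≤[ 𝒢 ] ℐ`.
    selective⇒ℰ𝒟⋠ : {𝒥 ℐ : Family ℕ 0ℓ} {𝒢 : Pred (ℕ → ℕ) 0ℓ} → IsSelectiveIdeal ℐ →
                     𝒥 ≤[ 𝒢 ] ℐ → ¬ (onω e ℰ𝒟 ≼ω₁[ ω^ω , 𝒢 ] 𝒥)
    selective⇒ℰ𝒟⋠ {ℐ = ℐ} sel 𝒥≤ℐ H with H ℐ (IsSelectiveIdeal.isIdeal sel) 𝒥≤ℐ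
    ... | 𝒜 , countable , U∉ , f , _ , ED≤
      with C , covered , sound ← enumerate {_≈_ = _≐_} em₁ ∁ (λ (p , _) (_ , q) x∉ x∈ → x∉ (p (q x∈))) countable
      -- `T` is contained in `S ∩ (f ⊢ image f T)`, which `trace` makes small.
      = T⁺ (⊆-closed T _ (λ {x} p → T⊆S p , x , p , refl) (trace (image f T) (graph-small f T inj)))
      where
      open IsSelectiveIdeal sel using (isIdeal)
      open Ideal isIdeal
      open Selective sel

      -- If a finite intersection of the `C n` were small, the complement of a finite union from `𝒜`
      -- would be too, putting `U` into `ℐ ⟨ 𝒜 ⟩`.
      generated : ∀ n → ∃[ Fs ] All (_∈ 𝒜) Fs × ∁ (⋃ˡ Fs) ⊆ ⋂< C n
      generated zero = [] , [] , λ _ → tt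
      generated (1+ n) with generated n | sound n
      ... | Fs , all , sub | inj₁ U⊆ = Fs , all , λ p → sub p , U⊆ tt
      ... | Fs , all , sub | inj₂ (F , F∈𝒜 , ∁F⊆) = F ∷ Fs , F∈𝒜 ∷ all , λ p → sub (p ∘ inj₂) , ∁F⊆ (p ∘ inj₁)

      pseudo = pseudoIntersection C λ n small →
        let Fs , all , sub = generated n
        in U∉ (Fs , all , ⊆-closed _ _ (λ (_ , p) → sub p) small)

      S = proj₁ pseudo
      S⁺ = proj₁ (proj₂ pseudo)
      S⊆*C = proj₂ (proj₂ pseudo)

      S∩⋃-finite : ∀ Fs → All (_∈ 𝒜) Fs → Finite (S ∩ ⋃ˡ Fs)
      S∩⋃-finite [] [] = empty⇒finite λ _ ()
      S∩⋃-finite (F ∷ Fs) (F∈𝒜 ∷ all) with covered F F∈𝒜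
      ... | n , C⊆∁F = finite-⊆
        (λ { (p , inj₁ q) → inj₁ (p , λ c → C⊆∁F c q) ; (p , inj₂ q) → inj₂ (p , q) })
        (finite-∪ (S⊆*C n) (S∩⋃-finite Fs all))

      trace : ∀ B → B ∈ onω e ℰ𝒟 → S ∩ (f ⊢ B) ∈ ℐ
      trace B B∈ℰ𝒟 with Fs , all , small ← ED≤ B B∈ℰ𝒟 = ⊆-∪-closed split small (finite _ (S∩⋃-finite Fs all))
        where
        split : S ∩ (f ⊢ B) ⊆ ((f ⊢ B) ∖ ⋃ˡ Fs) ∪ (S ∩ ⋃ˡ Fs)
        split {x} (p , q) with em {x ∈ ⋃ˡ Fs}
        ... | yes r = inj₂ (p , r)
        ... | no ¬r = inj₁ (q , ¬r)

      -- The part of `S` sent by `f` into the first `n` columns is small, so the rest of `S` stays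
      -- positive.
      transversal = injectiveSubset (column ∘ f) S λ n small →
        S⁺ (⊆-∪-closed (split n) small (trace (λ y → column y < n) (columns-small n)))
        where
        split : ∀ n → S ⊆ (S ∩ (λ x → n ≤ column (f x))) ∪ (S ∩ (λ x → column (f x) < n))
        split n {x} p with column (f x) <? n
        ... | yes r = inj₂ (p , r)
        ... | no ¬r = inj₁ (p , ≮⇒≥ ¬r)

      T = proj₁ transversal
      T⁺ = proj₁ (proj₂ transversal)
      T⊆S = proj₁ (proj₂ (proj₂ transversal))
      inj = proj₂ (proj₂ (proj₂ transversal))

    -- Selectivity of the pushforward from the failure of `ℰ𝒟`.

    module _ {ℐ : Family ℕ 0ℓ} (g : ℕ → ℕ) (ℐ-ideal : IsIdeal ℐ) (ideal : IsIdeal (pushforward g ℐ))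
             (noED : ∀ 𝒜 → Countable _≐_ 𝒜 → U ∉ ℐ ⟨ 𝒜 ⟩ → ¬ (onω e ℰ𝒟 ≤[ ω^ω ] (ℐ ⟨ 𝒜 ⟩))) where
      open Ideal ideal

      module _ (A : ℕ → 𝒫 ℕ) (A⁺ : ∀ n → A n ∈ pushforward g ℐ ⁺) (dec : ∀ n → A (1+ n) ⊆ A n) where

        layer : ℕ → 𝒫 ℕ
        layer n = A n ∖ A (1+ n)

        Selector : Set₁
        Selector = ∃[ S ] S ∈ pushforward g ℐ ⁺ × S ⊆ A 0 × (∀ n → ∣ S ∩ layer n ∣≤ 1)

        ⋂A : 𝒫 ℕ
        ⋂A x = ∀ n → x ∈ A n

        level : ℕ → ℕ
        level x with em {∃[ n ] x ∈ layer n}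
        ... | yes (n , _) = n
        -- The default is harmless: points in no layer lie outside `A 0`, whose complement enters
        -- `𝒜`, or in `⋂A`, small where `level` is used.
        ... | no _ = 0

        level-layer : ∀ {n x} → x ∈ layer n → level x ≡ n
        level-layer {n} {x} p with em {∃[ n ] x ∈ layer n}
        ... | yes (m , q) = layer-unique dec q p
        ... | no none = contradiction (n , p) none

        𝒜 : Family ℕ 0ℓ
        𝒜 B = ∃[ n ] ∁ (g ⊢ A n) ≐ B

        ∁A∈𝒜 : ∀ n → ∁ (g ⊢ A n) ∈ 𝒜
        ∁A∈𝒜 n = n , id , id

        -- As the sequence decreases, the largest index occurring in `Fs` gives one positive set
        -- missing the whole union.
        avoid : ∀ Fs → All (_∈ 𝒜) Fs → ∃[ N ] (g ⊢ A N) ⊆ ∁ (⋃ˡ Fs)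
        avoid [] [] = 0 , λ _ ()
        avoid (F ∷ Fs) ((n , _ , F⊆) ∷ all) with N , disjoint ← avoid Fs all =
          n ⊔ℕ N , λ p → [ (λ q → F⊆ q (antitone dec (m≤m⊔n n N) p))
                         , disjoint (antitone dec (m≤n⊔m n N) p) ]′

        𝒜-proper : U ∉ ℐ ⟨ 𝒜 ⟩
        𝒜-proper (Fs , all , small) with N , disjoint ← avoid Fs all =
          A⁺ N (IsIdeal.⊆-closed ℐ-ideal _ _ (λ p → tt , disjoint p) small)

        module _ (⋂A-small : ⋂A ∈ pushforward g ℐ) (none : ¬ Selector) where

          -- Using `x` itself as the row makes this injective, and the rows listed for column `n`
          -- are then points of the underlying set.
          encode : ℕ → ℕ
          encode x = from (level x , x)

          ED≤ : ∀ B → B ∈ onω e ℰ𝒟 → ((encode ∘ g) ⊢ B) ∈ ℐ ⟨ 𝒜 ⟩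
          ED≤ B (m , _ , ns , _ , exceptional) =
            Fs , ∁A∈𝒜 0 ∷ map⁺ (universal (λ n → ∁A∈𝒜 (1+ n)) ns) ,
            IsIdeal.⊆-closed ℐ-ideal _ _ remainder (∪-closed ⋂A ⋃T ⋂A-small ⋃T-small)
            where
            Bounded : ℕ → Set
            Bounded n = ∣ (λ k → from (n , k) ∈ B) ∣< m

            -- The first set removes preimages of points outside `A 0`; the one for `n` removes the
            -- preimage of layer `n`, and `ns` contains every column with too many points.
            Fs = ∁ (g ⊢ A 0) ∷ map (λ n → ∁ (g ⊢ A (1+ n))) ns

            xs : ℕ → List ℕ
            xs n with em {Bounded n}
            ... | yes (_ , _ , ys , _) = ys
            ... | no _ = []

            ∈xs : ∀ {n k} → Bounded n → from (n , k) ∈ B → ∃ λ (p : k ∈ˡ xs n) → toℕ (index p) < m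
            ∈xs {n} {k} bounded q with em {Bounded n}
            ... | yes (_ , l<m , ys , ≤l , c) = c k q , <-≤-trans (toℕ<n _) (≤-trans ≤l (<⇒≤ l<m))
            ... | no ¬bounded = contradiction bounded ¬bounded

            -- Collects the `i`-th list entry of every column, so `m` such sets exhaust the columns
            -- with fewer than `m` points.
            T : ℕ → 𝒫 ℕ
            T i x = ∃[ n ] x ∈ layer n × ∃ λ (p : x ∈ˡ xs n) → toℕ (index p) ≡ i

            T-unique : ∀ i n → AtMostOne (T i ∩ layer n)
            T-unique i n ((m , p , x∈ , i≡) , p′) ((l , q , y∈ , i≡′) , q′)
              with refl ← layer-unique dec p p′ | refl ← layer-unique dec q q′
              = index-injective (setoid ℕ) x∈ y∈ (toℕ-injective (trans i≡ (sym i≡′)))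

            T⊆A₀ : ∀ i → T i ⊆ A 0
            T⊆A₀ i (n , (p , _) , _) = antitone dec z≤n p

            ⋃T : 𝒫 ℕ
            ⋃T x = ∃[ i ] i < m × x ∈ T i

            ⋃T-small : ⋃T ∈ pushforward g ℐ
            -- A positive `T i` would be a selector, contrary to `none`.
            ⋃T-small = ⋃<-closed T m λ i _ → ¬¬-elim λ T⁺ →
              none (T i , T⁺ , T⊆A₀ i , λ n → atMostOne⇒≤1 (T-unique i n))

            cover : ∀ {x} → encode x ∈ B → x ∈ A 0 → (∀ {n} → n ∈ˡ ns → x ∈ A (1+ n)) → x ∈ ⋂A ∪ ⋃T
            cover {x} x∈B x∈A₀ x∈A = by-layer em
              where
              by-layer : Dec (∃[ n ] x ∈ layer n) → x ∈ ⋂A ∪ ⋃T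
              by-layer (no no-layer) = inj₁ all
                where
                all : ∀ n → x ∈ A n
                all zero = x∈A₀
                all (1+ n) = ¬¬-elim λ x∉ → no-layer (n , all n , x∉)
              by-layer (yes (n , x∈layer)) =
                let p , i<m = ∈xs bounded (subst (λ l → from (l , x) ∈ B) (level-layer x∈layer) x∈B)
                in inj₂ (_ , i<m , n , x∈layer , p , refl)
                where
                bounded : Bounded n
                bounded = ¬¬-elim λ unbounded → proj₂ x∈layer (x∈A (exceptional n unbounded))

            remainder : ((encode ∘ g) ⊢ B) ∖ ⋃ˡ Fs ⊆ g ⊢ (⋂A ∪ ⋃T)
            remainder {y} (p , y∉) = cover p
              (¬¬-elim (y∉ ∘ inj₁))
              (λ n∈ns → ¬¬-elim λ q → y∉ (inj₂ (∈⋃ˡ-map (λ n → ∁ (g ⊢ A (1+ n))) n∈ns q)))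

        select : Selector
        select with em₁ {Selector}
        ... | yes S = S
        ... | no none with em {⋂A ∈ pushforward g ℐ}
        -- A positive `⋂A` is disjoint from every layer, hence already a selector.
        ...   | no ⋂A⁺ = ⋂A , ⋂A⁺ , (λ p → p 0) , λ n → atMostOne⇒≤1 λ (p , _ , q) → contradiction (p (1+ n)) q
        ...   | yes small = contradiction (encode small none ∘ g , tt , ED≤ small none)
                              (noED 𝒜 (inj₂ ((λ n → ∁ (g ⊢ A n)) , λ _ → id)) 𝒜-proper)

      noℰ𝒟⇒selective : IsSelectiveIdeal (pushforward g ℐ)
      noℰ𝒟⇒selective = record { isIdeal = ideal ; selector = select }

    ℰ𝒟⋠⇒extendable : {𝒥 : Family ℕ 0ℓ} → IsIdeal 𝒥 →
                      ¬ (onω e ℰ𝒟 ≼ω₁[ ω^ω , ω^ω ] 𝒥) → ExtendableToSelective 𝒥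
    ℰ𝒟⋠⇒extendable {𝒥} 𝒥-ideal ¬≼ with em₁ {ExtendableToSelective 𝒥}
    ... | yes ext = ext
    ... | no ¬ext = contradiction (λ ℐ ideal 𝒥≤ℐ → extension ℐ ideal 𝒥≤ℐ em₁) ¬≼
      where
      Extension : Family ℕ 0ℓ → Set₁
      Extension ℐ = ∃ λ 𝒜 → Countable _≐_ 𝒜 × U ∉ ℐ ⟨ 𝒜 ⟩ × (onω e ℰ𝒟 ≤[ ω^ω ] (ℐ ⟨ 𝒜 ⟩))

      extension : ∀ ℐ → IsIdeal ℐ → 𝒥 ≤[ ω^ω ] ℐ → Dec (Extension ℐ) → Extension ℐ
      extension ℐ ideal _ (yes E) = E
      -- That the pushforward along `g` contains `𝒥` is literally the statement that `g` witnesses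
      -- `𝒥 ≤[ ω^ω ] ℐ`.
      extension ℐ ideal (g , _ , 𝒥≤ℐ) (no none) = contradiction
        (pushforward g ℐ ,
         noℰ𝒟⇒selective g ideal (pushforward-isIdeal 𝒥-ideal ideal 𝒥≤ℐ)
           (λ 𝒜 count U∉ ED≤ → none (𝒜 , count , U∉ , ED≤)) ,
         𝒥≤ℐ) ¬ext

  -- Dual ideals of ultrafilters; selectivity from homogeneous sets.

  dual : Family ℕ 0ℓ → Family ℕ 0ℓ
  dual 𝒰 B = ∁ B ∈ 𝒰

  module _ {𝒰 : Family ℕ 0ℓ} (⊇-closed : ∀ A B → A ⊆ B → A ∈ 𝒰 → B ∈ 𝒰) where

    *⇒dual : ∀ {B} → B ∈ 𝒰 * → B ∈ dual 𝒰
    *⇒dual {B} (A , A∈𝒰 , B⊆∁A , _) = ⊇-closed A (∁ B) (λ a b → B⊆∁A b a) A∈𝒰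

    dual⇒* : ∀ {B} → B ∈ dual 𝒰 → B ∈ 𝒰 *
    dual⇒* {B} ∁B∈𝒰 = ∁ B , ∁B∈𝒰 , (λ b ¬b → ¬b b) , ¬¬-elim

  module _ {𝒰 : Family ℕ 0ℓ} (isUltrafilter : IsUltrafilter 𝒰) where
    open IsUltrafilter isUltrafilter

    dual-isIdeal : IsIdeal (dual 𝒰)
    dual-isIdeal = record
      { ∪-closed = λ A B p q → ⊇-closed _ _ (λ (a , b) → [ a , b ]′) (∩-closed _ _ p q)
      ; ⊆-closed = λ A B A⊆B p → ⊇-closed _ _ (λ b a → b (A⊆B a)) p
      ; finite   = λ A fin → cofinite _ (finite-⊆ ¬¬-elim fin)
      ; proper   = λ p → proper (⊇-closed _ _ (λ ¬u → ¬u tt) p)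
      }

    disjoint : ∀ {A B} → A ∈ 𝒰 → B ∈ 𝒰 → A ⊈ ∁ B
    disjoint p q A⊆∁B = proper (⊇-closed _ _ (λ (a , b) → A⊆∁B a b) (∩-closed _ _ p q))

    homogeneous⇒selective : (∀ h → ∃[ B ] B ∈ 𝒰 × Homogeneous h B) → IsSelectiveIdeal (dual 𝒰)
    homogeneous⇒selective homogeneous = record { isIdeal = dual-isIdeal ; selector = select }
      where
      select : (A : ℕ → 𝒫 ℕ) → (∀ n → A n ∈ dual 𝒰 ⁺) → (∀ n → A (1+ n) ⊆ A n) →
               ∃[ S ] S ∈ dual 𝒰 ⁺ × S ⊆ A 0 × (∀ n → ∣ S ∩ (A n ∖ A (1+ n)) ∣≤ 1)
      select A A⁺ dec = let B , B∈𝒰 , hom = homogeneous level in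
        B ∩ A 0 , (λ p → disjoint p (∩-closed _ _ B∈𝒰 (A∈𝒰 0)) id) , proj₂ ,
        λ n → atMostOne⇒≤1 (unique hom B∈𝒰 n)
        where
        A∈𝒰 : ∀ n → A n ∈ 𝒰
        A∈𝒰 n = [ id , (λ p → contradiction p (A⁺ n)) ]′ (ultra (A n))

        layer : ℕ → 𝒫 ℕ
        layer n = A n ∖ A (1+ n)

        level : ℕ → ℕ
        level x with em {∃[ n ] x ∈ layer n}
        -- The shift reserves 0 for points in no layer, so that a successor value determines the
        -- layer in `level⇒layer`.
        ... | yes (n , _) = 1+ n
        ... | no _ = 0

        layer⇒level : ∀ {n x} → x ∈ layer n → level x ≡ 1+ n
        layer⇒level {n} {x} p with em {∃[ n ] x ∈ layer n}
        ... | yes (m , q) = cong 1+_ (layer-unique dec q p)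
        ... | no none = contradiction (n , p) none

        level⇒layer : ∀ {n x} → level x ≡ 1+ n → x ∈ layer n
        level⇒layer {n} {x} eq with em {∃[ n ] x ∈ layer n}
        ... | yes (m , q) with refl ← eq = q
        level⇒layer () | no _

        unique : ∀ {B} → Homogeneous level B → B ∈ 𝒰 → ∀ n → AtMostOne ((B ∩ A 0) ∩ layer n)
        -- One point of `B` in layer `n` puts all of `B` there, disjoint from `A (1+ n)`, although
        -- both belong to `𝒰`.
        unique (inj₁ const) B∈𝒰 n ((p , _) , p′) _ = ⊥-elim
          (disjoint B∈𝒰 (A∈𝒰 (1+ n)) λ q →
            proj₂ (level⇒layer (trans (const q p) (layer⇒level p′))))
        unique (inj₂ inj) _ n ((p , _) , p′) ((q , _) , q′) =
          inj p q (trans (layer⇒level p′) (sym (layer⇒level q′)))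

  -- The tower of length ω₁ and the ultrafilter it generates.

  module _ {W : Set} {_≺_ : Rel W 0ℓ} (isOmega₁ : IsOmega₁ W _≺_) where
    open IsOmega₁ isOmega₁
    open IsStrictTotalOrder isStrictTotalOrder using (compare)

    Least : (W → Set) → W → Set
    Least P u = P u × (∀ v → v ≺ u → ¬ P v)

    least : (P : W → Set) → ∃ P → ∃ (Least P)
    least P (w , Pw) = ¬¬-elim λ none →
      All.wfRec wellFounded 0ℓ (λ w → ¬ P w) (λ u ih Pu → none (u , Pu , λ v v≺u → ih v≺u)) w Pw

    least-unique : {P Q : W → Set} → (∀ {w} → P w → Q w) → (∀ {w} → Q w → P w) →
                   ∀ {u v} → Least P u → Least Q v → u ≡ v
    least-unique P⇒Q Q⇒P {u} {v} (Pu , below-u) (Qv , below-v) with compare u v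
    ... | tri< u≺v _ _ = contradiction (P⇒Q Pu) (below-v u u≺v)
    ... | tri≈ _ u≡v _ = u≡v
    ... | tri> _ _ v≺u = contradiction (Q⇒P Qv) (below-u v v≺u)

    module Tower (code : W → 𝒫 ℕ) (code-surjective : (A : 𝒫 ℕ) → ∃[ w ] code w ≐ A)
                 (e : ℕ ↔ (ℕ × ℕ)) {ℐ : Family ℕ 0ℓ} (sel : IsSelectiveIdeal ℐ) where
      open Inverse e using (to; from; strictlyInverseˡ)
      open IsSelectiveIdeal sel using (isIdeal)
      open Ideal isIdeal
      open Selective sel

      -- Codes functions as sets, so that the enumeration `code` of the subsets of ω also lists
      -- every function.
      graph : (ℕ → ℕ) → 𝒫 ℕ
      graph h k = h (proj₁ (to k)) ≡ proj₂ (to k)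

      graph-injective : ∀ {h h′} → graph h ⊆ graph h′ → ∀ x → h′ x ≡ h x
      graph-injective {h} {h′} sub x =
        trans (cong (h′ ∘ proj₁) (sym inverse)) (trans (sub on-graph) (cong proj₂ inverse))
        where
        inverse : to (from (x , h x)) ≡ (x , h x)
        inverse = strictlyInverseˡ (x , h x)

        on-graph : from (x , h x) ∈ graph h
        on-graph = trans (cong (h ∘ proj₁) inverse) (sym (cong proj₂ inverse))

      Segment : W → Set
      Segment w = ∀ {v} → v ≺ w → W

      -- Stage `w` handles the function whose graph has code `w`; `homogeneous` is vacuous if
      -- `code w` is no graph.
      record Extends (w : W) (σ : Segment w) (T : 𝒫 ℕ) : Set where
        field
          positive    : T ∈ ℐ ⁺
          almost-⊆    : ∀ {v} (v≺w : v ≺ w) → T ⊆* code (σ v≺w)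
          homogeneous : ∀ h → code w ≐ graph h → Homogeneous h T
      open Extends

      Extends-resp-≐ : ∀ {w} {σ : Segment w} {T T′} → T′ ≐ T → Extends w σ T → Extends w σ T′
      Extends-resp-≐ (T′⊆T , T⊆T′) E = record
        { positive    = λ small → positive E (⊆-closed _ _ T⊆T′ small)
        ; almost-⊆    = λ v≺w → ⊆*-trans (⊆⇒⊆* T′⊆T) (almost-⊆ E v≺w)
        ; homogeneous = λ h c → homogeneous-resp (λ _ → refl) T′⊆T (homogeneous E h c)
        }

      Extends-resp-≡ : ∀ {w} {σ σ′ : Segment w} → (∀ {v} (v≺w : v ≺ w) → σ v≺w ≡ σ′ v≺w) →
                       ∀ {T} → Extends w σ T → Extends w σ′ T
      Extends-resp-≡ σ≡σ′ {T} E = record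
        { positive    = positive E
        ; almost-⊆    = λ v≺w → subst (λ u → T ⊆* code u) (σ≡σ′ v≺w) (almost-⊆ E v≺w)
        ; homogeneous = homogeneous E
        }

      Candidate : (w : W) → Segment w → W → Set
      Candidate w σ u = Extends w σ (code u)

      -- Taking the least code, instead of the witness offered by excluded middle,
      -- makes the step extensional, as `unfold-wfRec` requires.
      step : (w : W) → Segment w → W
      step w σ with em {∃ (Candidate w σ)}
      ... | yes E = proj₁ (least (Candidate w σ) E)
      ... | no _  = w

      step-extends : ∀ {w} {σ : Segment w} → ∃ (Candidate w σ) → Candidate w σ (step w σ)
      step-extends {w} {σ} E with em {∃ (Candidate w σ)}
      ... | yes E′ = proj₁ (proj₂ (least (Candidate w σ) E′))
      ... | no none = contradiction E none

      step-cong : ∀ w {σ σ′ : Segment w} → (∀ {v} (v≺w : v ≺ w) → σ v≺w ≡ σ′ v≺w) →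
                  step w σ ≡ step w σ′
      step-cong w {σ} {σ′} σ≡σ′ with em {∃ (Candidate w σ)} | em {∃ (Candidate w σ′)}
      ... | yes E | yes E′ = least-unique (Extends-resp-≡ σ≡σ′) (Extends-resp-≡ (sym ∘ σ≡σ′))
                               (proj₂ (least _ E)) (proj₂ (least _ E′))
      ... | yes (u , E) | no none = contradiction (u , Extends-resp-≡ σ≡σ′ E) none
      ... | no none | yes (u , E) = contradiction (u , Extends-resp-≡ (sym ∘ σ≡σ′) E) none
      ... | no _ | no _ = refl

      open FixPoint wellFounded (λ _ → W) step step-cong using (unfold-wfRec)

      abstract
        stage : W → W
        stage = All.wfRec wellFounded 0ℓ (λ _ → W) step

        stage-unfold : ∀ w → stage w ≡ step w (λ {v} _ → stage v)
        stage-unfold w = unfold-wfRec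

      S : W → 𝒫 ℕ
      S w = code (stage w)

      Correct : W → Set
      Correct w = Extends w (λ {v} _ → stage v) (S w)

      refine : ∀ w T → T ∈ ℐ ⁺ → ∃[ T′ ] T′ ∈ ℐ ⁺ × T′ ⊆ T × (∀ h → code w ≐ graph h → Homogeneous h T′)
      refine w T T⁺ with em {∃[ h ] code w ≐ graph h}
      ... | no none = T , T⁺ , id , λ h c → contradiction (h , c) none
      ... | yes (h , _ , graph⊆) with T′ , T′⁺ , T′⊆T , hom ← homogeneousSubset h T T⁺ =
        T′ , T′⁺ , T′⊆T , λ h′ (⊆graph , _) →
          homogeneous-resp (graph-injective (⊆graph ∘ graph⊆)) id hom

      -- The later of the two stages works; recording that it is one of them keeps it below any
      -- common bound.
      Correct⇒chain : ∀ {u v} → Correct u → Correct v →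
                      ∃[ w ] (w ≡ u ⊎ w ≡ v) × S w ⊆* S u × S w ⊆* S v
      Correct⇒chain {u} {v} Cu Cv with compare u v
      ... | tri< u≺v _ _    = v , inj₂ refl , almost-⊆ Cv u≺v , ⊆⇒⊆* id
      ... | tri≈ _ refl _   = u , inj₁ refl , ⊆⇒⊆* id , ⊆⇒⊆* id
      ... | tri> _ _ v≺u    = u , inj₁ refl , ⊆⇒⊆* id , almost-⊆ Cu v≺u

      -- Only countably many stages precede `w`, so they have a positive pseudo-intersection, which
      -- is then thinned by `refine`.
      extension : ∀ w → (∀ {v} → v ≺ w → Correct v) → ∃[ T ] Extends w (λ {v} _ → stage v) T
      extension w ih
        with C , covered , sound ← enumerate {_≈_ = _≡_} em S (λ { refl refl → id }) (countableSegments w)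
        = T , record
          { positive    = T⁺
          ; almost-⊆    = λ v≺w → let n , C⊆ = covered _ v≺w in
                            ⊆*-trans (⊆⇒⊆* T⊆P) (⊆*-trans (P⊆*C n) (⊆⇒⊆* C⊆))
          ; homogeneous = T-hom
          }
        where
        -- The first alternative covers intersections of padding entries only, in particular when no
        -- stage precedes `w`.
        below : ∀ n → U ⊆ ⋂< C n ⊎ (∃[ v ] v ≺ w × S v ⊆* ⋂< C n)
        below zero = inj₁ id
        below (1+ n) with below n | sound n
        ... | inj₁ U⊆D | inj₁ U⊆C = inj₁ λ p → U⊆D p , U⊆C p
        ... | inj₁ U⊆D | inj₂ (v , v≺w , S⊆C) = inj₂ (v , v≺w , ⊆⇒⊆* λ p → U⊆D tt , S⊆C p)
        ... | inj₂ (v , v≺w , S⊆*D) | inj₁ U⊆C = inj₂ (v , v≺w , ⊆*-∩ S⊆*D (⊆⇒⊆* λ _ → U⊆C tt))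
        ... | inj₂ (u , u≺w , S⊆*D) | inj₂ (v , v≺w , S⊆C)
          with t , t∈ , S⊆*Su , S⊆*Sv ← Correct⇒chain (ih u≺w) (ih v≺w) =
          inj₂ (t , [ (λ { refl → u≺w }) , (λ { refl → v≺w }) ]′ t∈ ,
                ⊆*-∩ (⊆*-trans S⊆*Su S⊆*D) (⊆*-trans S⊆*Sv (⊆⇒⊆* S⊆C)))

        positive-⋂ : ∀ n → ⋂< C n ∈ ℐ ⁺
        positive-⋂ n small with below n
        ... | inj₁ U⊆ = proper (⊆-closed _ _ U⊆ small)
        ... | inj₂ (v , v≺w , S⊆*) = positive (ih v≺w) (⊆*-closed isIdeal S⊆* small)

        pseudo = pseudoIntersection C positive-⋂
        P = proj₁ pseudo
        P⊆*C = proj₂ (proj₂ pseudo)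

        refined = refine w P (proj₁ (proj₂ pseudo))
        T = proj₁ refined
        T⁺ = proj₁ (proj₂ refined)
        T⊆P = proj₁ (proj₂ (proj₂ refined))
        T-hom = proj₂ (proj₂ (proj₂ refined))

      abstract
        correct : ∀ w → Correct w
        correct = All.wfRec wellFounded 0ℓ Correct λ w ih →
          let T , E = extension w ih
              u , code≐T = code-surjective T
          -- Any code of the set `T` is a candidate, so `step` returns its least candidate rather
          -- than the default.
          in subst (Candidate w (λ {v} _ → stage v)) (sym (stage-unfold w))
               (step-extends (u , Extends-resp-≐ code≐T E))

      homogeneousStage : ∀ h → ∃[ w ] Homogeneous h (S w)
      homogeneousStage h =
        let w , code≐graph = code-surjective (graph h) in w , homogeneous (correct w) h code≐graph

      𝒰 : Family ℕ 0ℓ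
      𝒰 A = ∃[ w ] S w ⊆* A

      indicator : 𝒫 ℕ → ℕ → ℕ
      indicator A x with em {x ∈ A}
      ... | yes _ = 0
      ... | no _  = 1

      indicator-∈ : ∀ {A x} → x ∈ A → indicator A x ≡ 0
      indicator-∈ {A} {x} p with em {x ∈ A}
      ... | yes _ = refl
      ... | no ¬p = contradiction p ¬p

      indicator-∉ : ∀ {A x} → x ∉ A → indicator A x ≡ 1
      indicator-∉ {A} {x} ¬p with em {x ∈ A}
      ... | yes p = contradiction p ¬p
      ... | no _ = refl

      -- A stage homogeneous for the indicator decides `A`: if injective, it meets `A` in at most
      -- one point; if constant, any of its points tells the side.
      𝒰-ultra : ∀ A → A ∈ 𝒰 ⊎ ∁ A ∈ 𝒰
      𝒰-ultra A with homogeneousStage (indicator A)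
      ... | w , inj₂ inj = inj₂ (w , 1 , atMostOne⇒≤1 λ (p , ¬¬p) (q , ¬¬q) →
              inj p q (trans (indicator-∈ (¬¬-elim ¬¬p)) (sym (indicator-∈ (¬¬-elim ¬¬q)))))
      ... | w , inj₁ const with x , x∈S ← positive⇒inhabited isIdeal (positive (correct w)) | em {x ∈ A}
      ...   | yes x∈A = inj₁ (w , ⊆⇒⊆* λ p → ¬¬-elim λ ∉A →
                contradiction (trans (sym (indicator-∈ x∈A)) (trans (const x∈S p) (indicator-∉ ∉A))) λ ())
      ...   | no x∉A  = inj₂ (w , ⊆⇒⊆* λ p ∈A →
                contradiction (trans (sym (indicator-∈ ∈A)) (trans (const p x∈S) (indicator-∉ x∉A))) λ ())

      𝒰-positive : ∀ {A} → A ∈ 𝒰 → A ∈ ℐ ⁺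
      𝒰-positive (w , S⊆*A) A∈ℐ = positive (correct w) (⊆*-closed isIdeal S⊆*A A∈ℐ)

      𝒰-isUltrafilter : IsUltrafilter 𝒰
      𝒰-isUltrafilter = record
        { ∩-closed = λ { A B (u , Su⊆*A) (v , Sv⊆*B) →
            let w , _ , S⊆*Su , S⊆*Sv = Correct⇒chain (correct u) (correct v)
            in w , ⊆*-∩ (⊆*-trans S⊆*Su Su⊆*A) (⊆*-trans S⊆*Sv Sv⊆*B) }
        ; ⊇-closed = λ { A B A⊆B (w , S⊆*A) → w , ⊆*-trans S⊆*A (⊆⇒⊆* A⊆B) }
        -- Any stage would do; a code of `U` merely exhibits an element of `W`.
        ; cofinite = λ A fin → proj₁ (code-surjective U) , finite-⊆ proj₂ fin
        ; proper   = λ ∅∈𝒰 → 𝒰-positive ∅∈𝒰 (finite ∅ (empty⇒finite λ _ ()))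
        ; ultra    = 𝒰-ultra
        }

      𝒰-selective : IsSelectiveUltrafilter 𝒰
      𝒰-selective = 𝒰-isUltrafilter ,
        IsSelectiveIdeal-resp (dual⇒* ⊇-closed) (*⇒dual ⊇-closed)
          (homogeneous⇒selective 𝒰-isUltrafilter λ h →
            let w , hom = homogeneousStage h in S w , (w , ⊆⇒⊆* id) , hom)
        where open IsUltrafilter 𝒰-isUltrafilter using (⊇-closed)

      ℐ⊆𝒰* : ∀ {A} → A ∈ ℐ → A ∈ 𝒰 *
      ℐ⊆𝒰* {A} A∈ℐ = dual⇒* (IsUltrafilter.⊇-closed 𝒰-isUltrafilter)
        ([ (λ A∈𝒰 → contradiction A∈ℐ (𝒰-positive A∈𝒰)) , id ]′ (𝒰-ultra A))

  selectiveUltrafilter : CH → ℕ ↔ (ℕ × ℕ) → {ℐ : Family ℕ 0ℓ} → IsSelectiveIdeal ℐ →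
    ∃ λ (𝒰 : Family ℕ 0ℓ) → IsSelectiveUltrafilter 𝒰 × (∀ A → A ∈ ℐ → A ∈ 𝒰 *)
  selectiveUltrafilter (W , _ , isOmega₁ , bijection) e sel = 𝒰 , 𝒰-selective , λ A → ℐ⊆𝒰*
    where
    open Bijection bijection using (to; surjective)
    onto : (A : 𝒫 ℕ) → ∃[ w ] to w ≐ A
    onto A = proj₁ (surjective A) , proj₂ (surjective A) refl

    open Tower isOmega₁ to onto e sel

-- Monotonicity in the classes of functions, and the equivalences.

≤[]-mono : ∀ {ℓ₁ ℓ₂} {ℐ : Family ℕ ℓ₁} {𝒦 : Family ℕ ℓ₂} {ℱ 𝒢 : Pred (ℕ → ℕ) 0ℓ} →
           ℱ ⊆ 𝒢 → ℐ ≤[ ℱ ] 𝒦 → ℐ ≤[ 𝒢 ] 𝒦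
≤[]-mono ℱ⊆𝒢 (f , f∈ℱ , ℐ≤𝒦) = f , ℱ⊆𝒢 f∈ℱ , ℐ≤𝒦

-- A larger class of functions puts more ideals above `𝒥`, hence more ideals to treat.
≼ω₁-antitone : {ℐ 𝒥 : Family ℕ 0ℓ} {ℱ 𝒢 𝒢′ : Pred (ℕ → ℕ) 0ℓ} → 𝒢 ⊆ 𝒢′ →
               ℐ ≼ω₁[ ℱ , 𝒢′ ] 𝒥 → ℐ ≼ω₁[ ℱ , 𝒢 ] 𝒥
≼ω₁-antitone 𝒢⊆𝒢′ H ℐ ideal 𝒥≤ℐ = H ℐ ideal (≤[]-mono {𝒦 = ℐ} 𝒢⊆𝒢′ 𝒥≤ℐ)

theorem9p3 : ExcludedMiddle (suc 0ℓ) →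
    (e : ℕ ↔ (ℕ × ℕ)) (𝒥 : Family ℕ 0ℓ) → IsIdeal 𝒥 →
    ( (ExtendableToSelective 𝒥 ⇔ (¬ (onω e ℰ𝒟 ≼ω₁[ ω^ω , 1-1 ] 𝒥)))
    × (ExtendableToSelective 𝒥 ⇔ (¬ (onω e ℰ𝒟 ≼ω₁[ ω^ω , Fin-1 ] 𝒥)))
    × (ExtendableToSelective 𝒥 ⇔ (¬ (onω e ℰ𝒟 ≼ω₁[ ω^ω , ω^ω ] 𝒥))) )
    ×
    ( CH →
    (ExtendableToSelective 𝒥 ⇔ (∃ λ (𝒰 : Family ℕ 0ℓ) → IsSelectiveUltrafilter 𝒰 × (¬ (𝒥 -point) 𝒰)))
    × (ExtendableToSelective 𝒥 ⇔ (∃ λ (𝒰 : Family ℕ 0ℓ) → IsSelectiveUltrafilter 𝒰 × (¬ (𝒥 -weakUltrafilter) 𝒰)))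
    × (ExtendableToSelective 𝒥 ⇔ (∃ λ (𝒰 : Family ℕ 0ℓ) → IsSelectiveUltrafilter 𝒰 × (¬ (𝒥 -ultrafilter) 𝒰))) )
theorem9p3 em₁ e 𝒥 𝒥-ideal =
  (part₁ id , part₁ 1-1⊆Fin-1 , part₁ (λ _ → tt)) ,
  λ ch → part₂ ch id , part₂ ch 1-1⊆Fin-1 , part₂ ch (λ _ → tt)
  where
  open Classical em₁
  open Columns e

  1-1⊆Fin-1 : 1-1 ⊆ Fin-1
  1-1⊆Fin-1 inj n = 1 , atMostOne⇒≤1 λ p q → inj (trans (sym p) q)

  -- The identity lies in every `𝒢` containing `1-1`, and the converse passes to the largest class,
  -- so one argument serves all three.
  part₁ : {𝒢 : Pred (ℕ → ℕ) 0ℓ} → 1-1 ⊆ 𝒢 →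
          ExtendableToSelective 𝒥 ⇔ (¬ (onω e ℰ𝒟 ≼ω₁[ ω^ω , 𝒢 ] 𝒥))
  part₁ {𝒢} 1-1⊆𝒢 = mk⇔
    (λ (ℐ , sel , 𝒥⊆ℐ) → selective⇒ℰ𝒟⋠ sel (id , 1-1⊆𝒢 id , 𝒥⊆ℐ))
    (λ ¬≼ → ℰ𝒟⋠⇒extendable 𝒥-ideal (¬≼ ∘ ≼ω₁-antitone (λ _ → tt)))

  part₂ : CH → {𝒢 : Pred (ℕ → ℕ) 0ℓ} → 1-1 ⊆ 𝒢 →
          ExtendableToSelective 𝒥 ⇔
          (∃ λ (𝒰 : Family ℕ 0ℓ) → IsSelectiveUltrafilter 𝒰 × ¬ ¬ (𝒥 ≤[ 𝒢 ] (𝒰 *)))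
  part₂ ch {𝒢} 1-1⊆𝒢 = mk⇔
    (λ (ℐ , sel , 𝒥⊆ℐ) →
      let 𝒰 , 𝒰-sel , ℐ⊆𝒰* = selectiveUltrafilter ch e sel
      in 𝒰 , 𝒰-sel , λ 𝒥≰ → 𝒥≰ (id , 1-1⊆𝒢 id , λ A → ℐ⊆𝒰* A ∘ 𝒥⊆ℐ A))
    (λ (𝒰 , (ultra , sel) , ¬¬≤) →
      let ⊇-closed = IsUltrafilter.⊇-closed ultra in
      ℰ𝒟⋠⇒extendable 𝒥-ideal λ ≼ → ¬¬≤ λ (f , _ , 𝒥≤𝒰*) →
        selective⇒ℰ𝒟⋠ (IsSelectiveIdeal-resp (*⇒dual ⊇-closed) (dual⇒* ⊇-closed) sel)
          (f , tt , λ B B∈𝒥 → *⇒dual ⊇-closed (𝒥≤𝒰* B B∈𝒥)) ≼)
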